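{- Let $n$ be a positive integer and suppose that there exists a PC-graph (pseudo-cyclic strongly regular graph) of order $2n-1$. Then $$R(B_n,B_n)\ge 4n+1.$$
   Context: For a positive integer $n$, the book graph $B_n=K_2+\overline{K}_n$ is the graph consisting of $n$ triangles sharing a common edge. The Ramsey number $R(B_m,B_n)$ is the smallest integer $N$ such that every red/blue coloring of the edges of $K_N$ contains a red copy of $B_m$ or a blue copy of $B_n$ (copies are as not necessarily induced subgraphs). A strongly regular graph $\mathrm{srg}(\nu,k,\lambda,\mu)$ is a $k$-regular graph on $\nu$ vertices in which every pair of adjacent vertices has exactly $\lambda$ common neighbors and every pair of distinct non-adjacent vertices has exactly $\mu$ common neighbors. A pseudo-cyclic strongly regular graph (PC-graph) of order $\nu$ is a strongly regular graph $\mathrm{srg}\left(\nu,\frac{\nu-1}{2},\frac{\nu-5}{4},\frac{\nu-1}{4}\right)$. -}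

module Defs where

open import Data.Bool.Base using (Bool; true; false; _∨_)
open import Data.Bool.Properties using (∨-comm; ∨-idem)
open import Data.Fin.Base using (Fin; zero; suc; splitAt; combine; remQuot)
open import Data.Fin.Properties using (_≟_; any?; all?; remQuot-combine)
open import Data.Fin.Subset using (Subset; ∣_∣; _∩_)
open import Data.Fin.Subset.Properties using (anySubset?)
open import Data.Integer.Base as ℤ using (ℤ; +_)
open import Data.List.Base as List using (List; []; _∷_; length; filter; allFin)
open import Data.List.Properties using (length-tabulate)
open import Data.List.Relation.Binary.Sublist.Propositional using (_⊆_; []; _∷_; _∷ʳ_; ⊆-trans; minimum)
open import Data.List.Relation.Binary.Sublist.Propositional.Properties using (All-resp-⊆; filter-⊆)
open import Data.List.Relation.Unary.All as All using (All)
open import Data.List.Relation.Unary.All.Properties using (all-filter)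
open import Data.List.Relation.Unary.AllPairs using (AllPairs; []; _∷_)
open import Data.List.Relation.Unary.Unique.Propositional using (Unique)
open import Data.List.Relation.Unary.Unique.Propositional.Properties using (allFin⁺)
open import Data.Nat.Base as ℕ using (ℕ; zero; suc; _≤_; z≤n; s≤s)
import Data.Nat.Properties as ℕₚ
open import Data.Product.Base using (∃; ∃-syntax; _×_; _,_; proj₁; proj₂; uncurry)
open import Data.Sum.Base using (_⊎_; inj₁; inj₂)
open import Data.Unit.Base using (⊤; tt)
open import Data.Vec.Base as Vec using (Vec; []; _∷_; lookup)
open import Data.Vec.Properties using (lookup∘tabulate)
open import Function.Base using (_∘_)
open import Function.Definitions using (Injective)
open import Level using (0ℓ)
open import Relation.Binary.Core using (Rel)
open import Relation.Binary.Definitions using (Symmetric; Irreflexive; Decidable; DecidableEquality)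
open import Relation.Binary.PropositionalEquality
open import Relation.Nullary.Decidable
  using (Dec; yes; no; does; map′; ¬?; _×-dec_; _⊎-dec_; _→-dec_; decidable-stable)
open import Relation.Nullary.Negation using (¬_; contradiction)
import Relation.Unary as Unary

record Graph (n : ℕ) : Set₁ where
  field
    Adj     : Rel (Fin n) 0ℓ
    adj?    : Decidable Adj
    symm    : Symmetric Adj
    irrefl  : Irreflexive _≡_ Adj

open Graph public

neighbours : ∀ {n} → Graph n → Fin n → Subset n
neighbours G x = Vec.tabulate (λ y → does (adj? G x y))

-- The parameters range over ℤ because (ν - 5) / 4 is negative for ν = 1,
-- where the condition on adjacent pairs is void.
record IsSRG (ν : ℕ) (k l m : ℤ) (G : Graph ν) : Set where
  field
    regular     : ∀ x → + ∣ neighbours G x ∣ ≡ k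
    adjacent    : ∀ {x y} → Adj G x y →
                  + ∣ neighbours G x ∩ neighbours G y ∣ ≡ l
    nonAdjacent : ∀ {x y} → x ≢ y → ¬ Adj G x y →
                  + ∣ neighbours G x ∩ neighbours G y ∣ ≡ m

-- The three equations say k = (ν - 1) / 2, l = (ν - 5) / 4 and
-- m = (ν - 1) / 4, with all three quotients integral.
IsPCGraph : ∀ {ν} → Graph ν → Set
IsPCGraph {ν} G = ∃[ k ] ∃[ l ] ∃[ m ]
    (+ 2 ℤ.* k ≡ + ν ℤ.- + 1)
  × (+ 4 ℤ.* l ≡ + ν ℤ.- + 5)
  × (+ 4 ℤ.* m ≡ + ν ℤ.- + 1)
  × IsSRG ν k l m G

K : ∀ n → Graph n
K n = record
  { Adj    = _≢_
  ; adj?   = λ x y → ¬? (x ≟ y)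
  ; symm   = λ x≢y → x≢y ∘ sym
  ; irrefl = λ x≡y x≢y → x≢y x≡y
  }

complement : ∀ {n} → Graph n → Graph n
complement G = record
  { Adj    = λ x y → x ≢ y × ¬ Adj G x y
  ; adj?   = λ x y → ¬? (x ≟ y) ×-dec ¬? (adj? G x y)
  ; symm   = λ (x≢y , ¬xy) → x≢y ∘ sym , ¬xy ∘ symm G
  ; irrefl = λ x≡y (x≢y , _) → x≢y x≡y
  }

module _ {m n} (G : Graph m) (H : Graph n) where

  JoinAdj : Rel (Fin m ⊎ Fin n) 0ℓ
  JoinAdj (inj₁ x) (inj₁ y) = Adj G x y
  JoinAdj (inj₁ _) (inj₂ _) = ⊤
  JoinAdj (inj₂ _) (inj₁ _) = ⊤
  JoinAdj (inj₂ x) (inj₂ y) = Adj H x y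

  private
    joinAdj? : Decidable JoinAdj
    joinAdj? (inj₁ x) (inj₁ y) = adj? G x y
    joinAdj? (inj₁ _) (inj₂ _) = yes tt
    joinAdj? (inj₂ _) (inj₁ _) = yes tt
    joinAdj? (inj₂ x) (inj₂ y) = adj? H x y

    joinSymm : ∀ u v → JoinAdj u v → JoinAdj v u
    joinSymm (inj₁ _) (inj₁ _) = symm G
    joinSymm (inj₁ _) (inj₂ _) = λ _ → tt
    joinSymm (inj₂ _) (inj₁ _) = λ _ → tt
    joinSymm (inj₂ _) (inj₂ _) = symm H

    joinIrrefl : ∀ u → ¬ JoinAdj u u
    joinIrrefl (inj₁ _) = irrefl G refl
    joinIrrefl (inj₂ _) = irrefl H refl

  -- The graph join: the first m vertices carry G, the last n carry H.
  infixl 6 _⊕_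

  _⊕_ : Graph (m ℕ.+ n)
  _⊕_ = record
    { Adj    = λ x y → JoinAdj (splitAt m x) (splitAt m y)
    ; adj?   = λ x y → joinAdj? (splitAt m x) (splitAt m y)
    ; symm   = λ {x} {y} → joinSymm (splitAt m x) (splitAt m y)
    ; irrefl = λ { {x} refl → joinIrrefl (splitAt m x) }
    }

B : ∀ n → Graph (2 ℕ.+ n)
B n = K 2 ⊕ complement (K n)

data Colour : Set where
  red blue : Colour

-- Only the values at pairs of distinct vertices are colours of edges; the
-- values on the diagonal play no role.
record Colouring (N : ℕ) : Set where
  field
    colour : Fin N → Fin N → Colour
    csym   : ∀ x y → colour x y ≡ colour y x

open Colouring public

IsCopy : ∀ {N h} → Colouring N → Colour → Graph h → (Fin h → Fin N) → Set
IsCopy c k H f =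
  Injective _≡_ _≡_ f × (∀ {x y} → Adj H x y → colour c (f x) (f y) ≡ k)

HasCopy : ∀ {N h} → Colouring N → Colour → Graph h → Set
HasCopy c k H = ∃ (IsCopy c k H)

module _ {s t} (G : Graph s) (H : Graph t) where

  Arrows : ℕ → Set
  Arrows N = (c : Colouring N) → HasCopy c red G ⊎ HasCopy c blue H

  IsRamseyNumber : ℕ → Set
  IsRamseyNumber N = Arrows N × (∀ M → Arrows M → N ≤ M)

-- The rest proves that the Ramsey number exists: some N arrows (G , H) by
-- Ramsey's theorem, and Arrows is decidable, so there is a least such N.

private

  _≟ᶜ_ : DecidableEquality Colour
  red  ≟ᶜ red  = yes refl
  red  ≟ᶜ blue = no λ ()
  blue ≟ᶜ red  = no λ ()
  blue ≟ᶜ blue = yes refl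

  -- Ramsey's theorem for cliques

  bound : ℕ → ℕ → ℕ
  bound zero    t       = zero
  bound (suc s) zero    = zero
  bound (suc s) (suc t) = suc (bound s (suc t) ℕ.+ bound (suc s) t)

  module _ {A : Set} (c : A → A → Colour) where

    Clique : Colour → ℕ → List A → Set
    Clique k s xs =
      ∃[ ys ] ys ⊆ xs × length ys ≡ s × AllPairs (λ x y → c x y ≡ k) ys

    side : Colour → A → List A → List A
    side k x = filter (λ y → c x y ≟ᶜ k)

    side-length : ∀ x xs →
      length (side red x xs) ℕ.+ length (side blue x xs) ≡ length xs
    side-length x []       = refl
    side-length x (y ∷ xs) with c x y
    ... | red  = cong suc (side-length x xs)
    ... | blue = trans (ℕₚ.+-suc _ _) (cong suc (side-length x xs))

    weaken : ∀ {k k′ s} x xs → Clique k s (side k′ x xs) → Clique k s (x ∷ xs)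
    weaken x xs (ys , sub , len , ap) =
      ys , x ∷ʳ ⊆-trans sub (filter-⊆ _ xs) , len , ap

    extend : ∀ {k s} x xs → Clique k s (side k x xs) → Clique k (suc s) (x ∷ xs)
    extend x xs (ys , sub , len , ap) =
        x ∷ ys
      , refl ∷ ⊆-trans sub (filter-⊆ _ xs)
      , cong suc len
      , All-resp-⊆ sub (all-filter _ xs) ∷ ap

    split : ∀ {a b} p q → a ℕ.+ b ≤ p ℕ.+ q → a ≤ p ⊎ b ≤ q
    split {a} {b} p q le with ℕₚ.≤-<-connex a p
    ... | inj₁ a≤p = inj₁ a≤p
    ... | inj₂ p<a with ℕₚ.≤-<-connex b q
    ...   | inj₁ b≤q = inj₂ b≤q
    ...   | inj₂ q<b = contradiction (ℕₚ.+-mono-< p<a q<b) (ℕₚ.≤⇒≯ le)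

    cliques : ∀ s t xs → bound s t ≤ length xs →
              Clique red s xs ⊎ Clique blue t xs
    cliques zero    t       xs       _        = inj₁ ([] , minimum xs , refl , [])
    cliques (suc s) zero    xs       _        = inj₂ ([] , minimum xs , refl , [])
    cliques (suc s) (suc t) (x ∷ xs) (s≤s le)
      with split (length (side red x xs)) (length (side blue x xs))
             (subst (_ ≤_) (sym (side-length x xs)) le)
    ... | inj₁ r with cliques s (suc t) (side red x xs) r
    ...   | inj₁ q = inj₁ (extend x xs q)
    ...   | inj₂ q = inj₂ (weaken x xs q)
    cliques (suc s) (suc t) (x ∷ xs) (s≤s le)
        | inj₂ b with cliques (suc s) t (side blue x xs) b
    ...   | inj₁ q = inj₁ (weaken x xs q)
    ...   | inj₂ q = inj₂ (extend x xs q)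

  unique-⊆ : ∀ {A : Set} {xs ys : List A} → ys ⊆ xs → Unique xs → Unique ys
  unique-⊆ []             u        = u
  unique-⊆ (_ ∷ʳ sub)  (_ ∷ u)  = unique-⊆ sub u
  unique-⊆ (refl ∷ sub) (px ∷ u) = All-resp-⊆ sub px ∷ unique-⊆ sub u

  lookupAll : ∀ {A : Set} {P : A → Set} {xs} → All P xs →
              ∀ i → P (List.lookup xs i)
  lookupAll (px All.∷ _)   zero    = px
  lookupAll (_  All.∷ pxs) (suc i) = lookupAll pxs i

  pairs : ∀ {A : Set} {R : Rel A 0ℓ} → Symmetric R → ∀ {xs} → AllPairs R xs →
          ∀ i j → i ≢ j → R (List.lookup xs i) (List.lookup xs j)
  pairs s (p ∷ ps) zero    zero    i≢j = contradiction refl i≢j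
  pairs s (p ∷ ps) zero    (suc j) _   = lookupAll p j
  pairs s (p ∷ ps) (suc i) zero    _   = s (lookupAll p i)
  pairs s (p ∷ ps) (suc i) (suc j) i≢j = pairs s ps i j (i≢j ∘ cong suc)

  clique⇒copy : ∀ {N h} (c : Colouring N) k (H : Graph h) →
                Clique (colour c) k h (allFin N) → HasCopy c k H
  clique⇒copy {N} c k H (ys , sub , refl , ap) = List.lookup ys , inj , mono
    where
    inj : Injective _≡_ _≡_ (List.lookup ys)
    inj {i} {j} eq with i ≟ j
    ... | yes i≡j = i≡j
    ... | no  i≢j =
      contradiction eq (pairs (λ ne → ne ∘ sym) (unique-⊆ sub (allFin⁺ N)) i j i≢j)

    mono : ∀ {x y} → Adj H x y → colour c (List.lookup ys x) (List.lookup ys y) ≡ k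
    mono {x} {y} xy =
      pairs (λ {u} {v} → trans (csym c v u)) ap x y (λ x≡y → irrefl H x≡y xy)

  arrows-bound : ∀ {s t} (G : Graph s) (H : Graph t) → Arrows G H (bound s t)
  arrows-bound {s} {t} G H c
    with cliques (colour c) s t (allFin _)
           (ℕₚ.≤-reflexive (sym (length-tabulate {n = bound s t} (λ i → i))))
  ... | inj₁ q = inj₁ (clique⇒copy c red G q)
  ... | inj₂ q = inj₂ (clique⇒copy c blue H q)

  -- Decidability of Arrows

  anyVec? : ∀ {N} h {P : Vec (Fin N) h → Set} → Unary.Decidable P → Dec (∃ P)
  anyVec? zero    P? = map′ ([] ,_) (λ { ([] , p) → p }) (P? [])
  anyVec? (suc h) P? =
    map′ (λ (x , v , p) → x ∷ v , p) (λ { (x ∷ v , p) → x , v , p })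
         (any? λ x → anyVec? h (P? ∘ (x ∷_)))

  isCopy? : ∀ {N h} (c : Colouring N) k (H : Graph h) → Unary.Decidable (IsCopy c k H)
  isCopy? c k H f =
    map′ (λ p {x} {y} → p x y) (λ p x y → p)
         (all? λ x → all? λ y → (f x ≟ f y) →-dec (x ≟ y))
    ×-dec
    map′ (λ p {x} {y} → p x y) (λ p x y → p)
         (all? λ x → all? λ y → adj? H x y →-dec (colour c (f x) (f y) ≟ᶜ k))

  isCopy-resp : ∀ {N h} {c d : Colouring N} {k} {H : Graph h} {f g} →
                (∀ x y → colour c x y ≡ colour d x y) → f ≗ g →
                IsCopy c k H f → IsCopy d k H g
  isCopy-resp {d = d} c≗d f≗g (inj , mono) =
      (λ {x} {y} eq → inj (trans (f≗g x) (trans eq (sym (f≗g y)))))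
    , (λ {x} {y} xy →
         trans (sym (trans (c≗d _ _) (cong₂ (colour d) (f≗g x) (f≗g y)))) (mono xy))

  hasCopy? : ∀ {N h} (c : Colouring N) k (H : Graph h) → Dec (HasCopy c k H)
  hasCopy? {h = h} c k H =
    map′ (λ (v , p) → lookup v , p)
         (λ (f , p) → Vec.tabulate f ,
            isCopy-resp {c = c} {d = c} {H = H} (λ _ _ → refl)
              (sym ∘ lookup∘tabulate f) p)
         (anyVec? h (isCopy? c k H ∘ lookup))

  toColour : Bool → Colour
  toColour true  = red
  toColour false = blue

  isRed : Colour → Bool
  isRed red  = true
  isRed blue = false

  toColour-isRed : ∀ k → toColour (isRed k) ≡ k
  toColour-isRed red  = refl
  toColour-isRed blue = refl

  decode : ∀ {N} → Subset (N ℕ.* N) → Colouring N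
  decode p = record
    { colour = λ x y → toColour (lookup p (combine x y) ∨ lookup p (combine y x))
    ; csym   = λ x y →
        cong toColour (∨-comm (lookup p (combine x y)) (lookup p (combine y x)))
    }

  encode : ∀ {N} → Colouring N → Subset (N ℕ.* N)
  encode {N} c = Vec.tabulate (λ i → isRed (uncurry (colour c) (remQuot N i)))

  lookup-encode : ∀ {N} (c : Colouring N) x y →
                  lookup (encode c) (combine x y) ≡ isRed (colour c x y)
  lookup-encode c x y =
    trans (lookup∘tabulate _ (combine x y))
          (cong (isRed ∘ uncurry (colour c)) (remQuot-combine x y))

  decode-encode : ∀ {N} (c : Colouring N) x y →
                  colour (decode (encode c)) x y ≡ colour c x y
  decode-encode c x y
    rewrite lookup-encode c x y | lookup-encode c y x | csym c y x
          | ∨-idem (isRed (colour c x y)) = toColour-isRed (colour c x y)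

  arrows? : ∀ {s t} (G : Graph s) (H : Graph t) → Unary.Decidable (Arrows G H)
  arrows? G H N =
    map′ to (λ arr (p , ¬good) → ¬good (arr (decode p)))
         (¬? (anySubset? λ p → ¬? (good? (decode p))))
    where
    Good : Colouring N → Set
    Good c = HasCopy c red G ⊎ HasCopy c blue H

    good? : Unary.Decidable Good
    good? c = hasCopy? c red G ⊎-dec hasCopy? c blue H

    to : ¬ (∃ λ p → ¬ Good (decode p)) → Arrows G H N
    to noBad c
      with decidable-stable (good? (decode (encode c))) (λ ¬g → noBad (encode c , ¬g))
    ... | inj₁ (f , p) = inj₁ (f ,
            isCopy-resp {c = decode (encode c)} {d = c} {H = G} (decode-encode c) (λ _ → refl) p)
    ... | inj₂ (f , p) = inj₂ (f ,
            isCopy-resp {c = decode (encode c)} {d = c} {H = H} (decode-encode c) (λ _ → refl) p)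

  least : ∀ {P : ℕ → Set} → Unary.Decidable P → ∀ b → P b →
          ∃[ n ] P n × (∀ m → P m → n ≤ m)
  least P? b pb with P? zero
  ... | yes p0 = zero , p0 , λ _ _ → z≤n
  least P? zero    pb | no ¬p0 = contradiction pb ¬p0
  least P? (suc b) pb | no ¬p0 with least (P? ∘ suc) b pb
  ... | n , pn , min = suc n , pn , λ where
    zero    p0 → contradiction p0 ¬p0
    (suc m) pm → s≤s (min m pm)

ramseyNumberExists : ∀ {s t} (G : Graph s) (H : Graph t) → ∃ (IsRamseyNumber G H)
ramseyNumberExists {s} {t} G H = least (arrows? G H) (bound s t) (arrows-bound G H)

R : ∀ {s t} → Graph s → Graph t → ℕ
R G H = proj₁ (ramseyNumberExists G H)

R-isRamseyNumber : ∀ {s t} (G : Graph s) (H : Graph t) → IsRamseyNumber G H (R G H)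
R-isRamseyNumber G H = proj₂ (ramseyNumberExists G H)

-- Let H be the cone over the PC-graph G, on 2n vertices with adjacency
-- indicator e. For distinct x, y, the set of z with e x z ≠ e y z has n + 1
-- elements if x and y are adjacent and n - 1 otherwise, so that H represents a
-- regular two-graph. Colour pairs in Bool × H by the associated double cover
-- (a Taylor graph): (s , x) and (t , y) with x ≠ y are coloured by
-- the parity of e x y + s + t, and the antipodal pairs (s , x), (t , x) are all red.
-- A page (c , z) of a monochromatic book with spine (s , x), (t , y), of
-- either colour, then satisfies e x z + e y z = s + t, and c is determined by z.
-- So a book with n pages gives n such z, all distinct from x and y. The set of
-- these z has size n - 1, or else has size n + 1 and contains x and y as well.
module Submission where

open import Defs
open import Data.Bool.Base using (Bool; true; false; not; _xor_)
open import Data.Bool.Properties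
  using (not-injective; xor-comm; xor-same; xor-annihilates-not)
open import Data.Empty using (⊥)
open import Data.Fin.Base using (Fin; zero; suc; inject≤)
open import Data.Fin.Properties using (_≟_; suc-injective; 0≢1+n; inject≤-injective; 2↔Bool; *↔×)
open import Data.Fin.Subset using (Subset; ∣_∣; _∩_; _∈_; _-_; ∁)
open import Data.Fin.Subset.Properties using (∣∁p∣≡n∸∣p∣; x∈p∧x≢y⇒x∈p-y; x∈p⇒∣p-x∣<∣p∣)
open import Data.Integer.Base as ℤ using () renaming (+_ to pos)
import Data.Integer.Properties as ℤₚ
open import Data.Nat.Base using (ℕ; zero; suc; NonZero; _+_; _*_; _∸_; _≤_; _≥_; z≤n)
open import Data.Nat.Properties
  using (+-comm; ≤-reflexive; ≤-trans; ≤-<-trans; 1+n≰n; ≰⇒>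
        ; +-suc; +-identityʳ; +-cancelʳ-≡; *-cancelˡ-≡; m+n∸m≡n; _≤?_)
open import Data.Nat.Tactic.RingSolver using (solve-∀)
open import Data.Product.Base using (∃; _×_; _,_; proj₁; proj₂)
open import Data.Product.Function.NonDependent.Propositional using (_×-↔_)
open import Data.Sum.Base using (_⊎_; inj₁; inj₂; [_,_]′)
open import Data.Vec.Base using ([]; _∷_; lookup; tabulate; zipWith)
open import Data.Vec.Properties
  using (lookup∘tabulate; lookup-zipWith; lookup-map; lookup⇒[]=; zipWith-comm)
open import Function.Base using (_∘_)
open import Function.Bundles using (Injection; Inverse; _↔_; mk⇔)
open import Function.Construct.Composition using (_↔-∘_)
open import Function.Construct.Identity using (↔-id)
open import Function.Definitions using (Injective)
open import Function.Properties.Inverse using (↔⇒↣)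
open import Relation.Binary.PropositionalEquality
open import Relation.Nullary.Decidable using (yes; no; does; does-⇔; dec-false)
open import Relation.Nullary.Negation using (¬_; contradiction)

-- Parities: addition modulo 2

xor-cancelˡ : ∀ a {b c} → a xor b ≡ a xor c → b ≡ c
xor-cancelˡ false eq = eq
xor-cancelˡ true  eq = not-injective eq

xor-cancelʳ : ∀ a {b c} → b xor a ≡ c xor a → b ≡ c
xor-cancelʳ a {b} {c} eq =
  xor-cancelˡ a (trans (xor-comm a b) (trans eq (xor-comm c a)))

-- Modulo 2, both equations say that `a + b + s + t` vanishes.
xor-exchange : ∀ a b s t → a xor s ≡ b xor t → a xor b ≡ s xor t
xor-exchange false false s t refl = sym (xor-same s)
xor-exchange true  true  s t eq   =
  trans (sym (xor-same s)) (cong (s xor_) (not-injective eq))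
xor-exchange false true  s t refl = xor-not t
  where
  xor-not : ∀ t → true ≡ not t xor t
  xor-not false = refl
  xor-not true  = refl
xor-exchange true  false s t refl = xor-not s
  where
  xor-not : ∀ s → true ≡ s xor not s
  xor-not false = refl
  xor-not true  = refl

xor-exchange₂ : ∀ a b c s t → a xor (c xor s) ≡ b xor (c xor t) → a xor b ≡ s xor t
xor-exchange₂ a b false s t eq = xor-exchange a b s t eq
xor-exchange₂ a b true  s t eq =
  trans (xor-exchange a b (not s) (not t) eq) (xor-annihilates-not s t)

≡-or-≡not : ∀ a b → a ≡ b ⊎ a ≡ not b
≡-or-≡not false false = inj₁ refl
≡-or-≡not false true  = inj₂ refl
≡-or-≡not true  false = inj₂ refl
≡-or-≡not true  true  = inj₁ refl

-- Counting in finite subsets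

injection⇒≤∣∣ : ∀ {m N} (p : Subset N) (f : Fin m → Fin N) → Injective _≡_ _≡_ f →
                (∀ i → f i ∈ p) → m ≤ ∣ p ∣
injection⇒≤∣∣ {zero}  p f inj f∈p = z≤n
injection⇒≤∣∣ {suc m} p f inj f∈p =
  ≤-<-trans
    (injection⇒≤∣∣ (p - f zero) (f ∘ suc) (suc-injective ∘ inj)
      (λ i → x∈p∧x≢y⇒x∈p-y (f∈p (suc i)) (0≢1+n ∘ sym ∘ inj)))
    (x∈p⇒∣p-x∣<∣p∣ (f∈p zero))

infixl 6 _△_

_△_ : ∀ {N} → Subset N → Subset N → Subset N
_△_ = zipWith _xor_

-- The common elements are the ones that the right side counts twice.
∣p△q∣+2∣p∩q∣≡∣p∣+∣q∣ : ∀ {N} (p q : Subset N) →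
                         ∣ p △ q ∣ + 2 * ∣ p ∩ q ∣ ≡ ∣ p ∣ + ∣ q ∣
∣p△q∣+2∣p∩q∣≡∣p∣+∣q∣ []          []          = refl
∣p△q∣+2∣p∩q∣≡∣p∣+∣q∣ (false ∷ p) (false ∷ q) = ∣p△q∣+2∣p∩q∣≡∣p∣+∣q∣ p q
∣p△q∣+2∣p∩q∣≡∣p∣+∣q∣ (false ∷ p) (true  ∷ q) =
  trans (cong suc (∣p△q∣+2∣p∩q∣≡∣p∣+∣q∣ p q)) (sym (+-suc ∣ p ∣ ∣ q ∣))
∣p△q∣+2∣p∩q∣≡∣p∣+∣q∣ (true  ∷ p) (false ∷ q) = cong suc (∣p△q∣+2∣p∩q∣≡∣p∣+∣q∣ p q)
∣p△q∣+2∣p∩q∣≡∣p∣+∣q∣ (true  ∷ p) (true  ∷ q) = begin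
  ∣ p △ q ∣ + 2 * suc ∣ p ∩ q ∣        ≡⟨ shift ∣ p △ q ∣ ∣ p ∩ q ∣ ⟩
  2 + (∣ p △ q ∣ + 2 * ∣ p ∩ q ∣)      ≡⟨ cong (λ s → 2 + s) (∣p△q∣+2∣p∩q∣≡∣p∣+∣q∣ p q) ⟩
  2 + (∣ p ∣ + ∣ q ∣)                  ≡⟨ cong suc (sym (+-suc ∣ p ∣ ∣ q ∣)) ⟩
  suc ∣ p ∣ + suc ∣ q ∣                ∎
  where
  open ≡-Reasoning
  shift : ∀ a b → a + 2 * suc b ≡ 2 + (a + 2 * b)
  shift = solve-∀

full△p≡∁p : ∀ {N} (p : Subset N) → tabulate (λ _ → true) △ p ≡ ∁ p
full△p≡∁p []      = refl
full△p≡∁p (x ∷ p) = cong (not x ∷_) (full△p≡∁p p)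

-- Separating sets in a graph

adjᵇ : ∀ {N} → Graph N → Fin N → Fin N → Bool
adjᵇ H x y = does (adj? H x y)

adjᵇ-sym : ∀ {N} (H : Graph N) x y → adjᵇ H x y ≡ adjᵇ H y x
adjᵇ-sym H x y = does-⇔ (mk⇔ (symm H) (symm H)) (adj? H x y) (adj? H y x)

adjᵇ-refl : ∀ {N} (H : Graph N) x → adjᵇ H x x ≡ false
adjᵇ-refl H x = dec-false (adj? H x x) (irrefl H refl)

separating : ∀ {N} → Graph N → Fin N → Fin N → Subset N
separating H x y = neighbours H x △ neighbours H y

separating-comm : ∀ {N} (H : Graph N) x y → separating H x y ≡ separating H y x
separating-comm H x y = zipWith-comm xor-comm (neighbours H x) (neighbours H y)

lookup-separating : ∀ {N} (H : Graph N) x y z →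
                    lookup (separating H x y) z ≡ adjᵇ H x z xor adjᵇ H y z
lookup-separating H x y z =
  trans (lookup-zipWith _xor_ z (neighbours H x) (neighbours H y))
        (cong₂ _xor_ (lookup∘tabulate _ z) (lookup∘tabulate _ z))

-- The graph H represents a regular two-graph on 2 (m + 1) points.
record IsBalanced (m : ℕ) {N} (H : Graph N) : Set where
  field
    order       : N ≡ 2 * suc m
    adjacent    : ∀ {x y} → Adj H x y → ∣ separating H x y ∣ ≡ 2 + m
    nonAdjacent : ∀ {x y} → x ≢ y → ¬ Adj H x y → ∣ separating H x y ∣ ≡ m

-- The cone over a PC-graph of order 2m + 1

a*b≡c-d⇒a*b+d≡c : ∀ a b c d → pos a ℤ.* pos b ≡ pos c ℤ.- pos d → a * b + d ≡ c
a*b≡c-d⇒a*b+d≡c a b c d eq = ℤₚ.+-injective (begin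
  pos (a * b) ℤ.+ pos d               ≡⟨ cong (ℤ._+ pos d) (ℤₚ.pos-* a b) ⟩
  pos a ℤ.* pos b ℤ.+ pos d           ≡⟨ cong (ℤ._+ pos d) eq ⟩
  pos c ℤ.- pos d ℤ.+ pos d           ≡⟨ ℤₚ.+-assoc (pos c) (ℤ.- pos d) (pos d) ⟩
  pos c ℤ.+ (ℤ.- pos d ℤ.+ pos d)     ≡⟨ cong (ℤ._+_ (pos c)) (ℤₚ.+-inverseˡ (pos d)) ⟩
  pos c ℤ.+ pos 0                     ≡⟨ ℤₚ.+-identityʳ (pos c) ⟩
  pos c                               ∎)
  where open ≡-Reasoning

module _ (m : ℕ) (G : Graph (2 * suc m ∸ 1)) where

  private
    ν≡2m+1 : 2 * suc m ∸ 1 ≡ 2 * m + 1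
    ν≡2m+1 = h m
      where
      h : ∀ m → m + suc (m + 0) ≡ 2 * m + 1
      h = solve-∀

    -- Common form of the three parameter conditions, with `n = suc m`: the hypotheses give
    -- `a * b + d = 2 * m + 1`, so any `c` with `2 * c + 1` on the other side is `m`.
    halve : ∀ a b d {l} → pos a ℤ.* l ≡ pos (2 * suc m ∸ 1) ℤ.- pos d → pos b ≡ l →
            ∀ c → 2 * c + 1 ≡ a * b + d → c ≡ m
    halve a b d eq refl c eq′ = *-cancelˡ-≡ c m 2 (+-cancelʳ-≡ 1 (2 * c) (2 * m)
      (trans eq′ (trans (a*b≡c-d⇒a*b+d≡c a b _ d eq) ν≡2m+1)))

  cone-balanced : IsPCGraph G → IsBalanced m (K 1 ⊕ G)
  cone-balanced (k , l , μ , 2k≡ , 4l≡ , 4μ≡ , srg) = record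
    -- `1 + (2 * suc m ∸ 1)` reduces to `2 * suc m`.
    { order       = refl
    ; adjacent    = λ {x} {y} → adjacent {x} {y}
    ; nonAdjacent = λ {x} {y} → nonAdjacent {x} {y}
    }
    where
    module G = IsSRG srg

    common : Fin (2 * suc m ∸ 1) → Fin (2 * suc m ∸ 1) → ℕ
    common x y = ∣ neighbours G x ∩ neighbours G y ∣

    degree : ∀ x → ∣ neighbours G x ∣ ≡ m
    degree x = halve 2 (∣ neighbours G x ∣) 1 2k≡ (G.regular x) _ refl

    common-adjacent : ∀ {x y} → Adj G x y → 2 + 2 * common x y ≡ m
    common-adjacent {x} {y} xy =
      halve 4 (common x y) 5 4l≡ (G.adjacent xy) (2 + 2 * common x y) (h (common x y))
      where
      h : ∀ c → 2 * (2 + 2 * c) + 1 ≡ 4 * c + 5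
      h = solve-∀

    common-nonAdjacent : ∀ {x y} → x ≢ y → ¬ Adj G x y → 2 * common x y ≡ m
    common-nonAdjacent {x} {y} x≢y ¬xy =
      halve 4 (common x y) 1 4μ≡ (G.nonAdjacent x≢y ¬xy) (2 * common x y) (h (common x y))
      where
      h : ∀ c → 2 * (2 * c) + 1 ≡ 4 * c + 1
      h = solve-∀

    ∣△∣+2∣∩∣≡2m : ∀ x y → ∣ separating G x y ∣ + 2 * common x y ≡ m + m
    ∣△∣+2∣∩∣≡2m x y =
      trans (∣p△q∣+2∣p∩q∣≡∣p∣+∣q∣ (neighbours G x) (neighbours G y))
            (cong₂ _+_ (degree x) (degree y))

    -- The outer `suc` counts the apex, adjacent to `suc y` but not to itself. Inside `G`, the
    -- separating vertices are the `m + 1` that are not neighbours of `y`.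
    apex : ∀ y → ∣ separating (K 1 ⊕ G) zero (suc y) ∣ ≡ 2 + m
    apex y = cong suc (begin
      ∣ tabulate (λ _ → true) △ neighbours G y ∣ ≡⟨ cong ∣_∣ (full△p≡∁p (neighbours G y)) ⟩
      ∣ ∁ (neighbours G y) ∣                     ≡⟨ ∣∁p∣≡n∸∣p∣ (neighbours G y) ⟩
      (2 * suc m ∸ 1) ∸ ∣ neighbours G y ∣       ≡⟨ cong ((2 * suc m ∸ 1) ∸_) (degree y) ⟩
      m + suc (m + 0) ∸ m                        ≡⟨ m+n∸m≡n m (suc (m + 0)) ⟩
      suc (m + 0)                                ≡⟨ cong suc (+-identityʳ m) ⟩
      suc m                                      ∎)
      where open ≡-Reasoning

    adjacent : ∀ {x y} → Adj (K 1 ⊕ G) x y → ∣ separating (K 1 ⊕ G) x y ∣ ≡ 2 + m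
    adjacent {zero}  {zero}  0≢0 = contradiction refl 0≢0
    adjacent {zero}  {suc y} _   = apex y
    adjacent {suc x} {zero}  _   =
      trans (cong ∣_∣ (separating-comm (K 1 ⊕ G) (suc x) zero)) (apex x)
    -- The apex is a common neighbour of the two vertices, so only vertices of `G` can separate
    -- them.
    adjacent {suc x} {suc y} xy  =
      +-cancelʳ-≡ (2 * c) _ (2 + m)
        (trans (∣△∣+2∣∩∣≡2m x y) (trans (cong (m +_) (sym (common-adjacent xy))) (h m c)))
      where
      c = common x y
      h : ∀ m c → m + (2 + 2 * c) ≡ 2 + m + 2 * c
      h = solve-∀

    nonAdjacent : ∀ {x y} → x ≢ y → ¬ Adj (K 1 ⊕ G) x y → ∣ separating (K 1 ⊕ G) x y ∣ ≡ m
    nonAdjacent {zero}  {zero}  0≢0 _   = contradiction refl 0≢0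
    nonAdjacent {zero}  {suc y} _   ¬0y = contradiction _ ¬0y
    nonAdjacent {suc x} {zero}  _   ¬x0 = contradiction _ ¬x0
    nonAdjacent {suc x} {suc y} x≢y ¬xy =
      +-cancelʳ-≡ (2 * c) _ m
        (trans (∣△∣+2∣∩∣≡2m x y) (cong (m +_) (sym (common-nonAdjacent (x≢y ∘ cong suc) ¬xy))))
      where c = common x y

-- Vertices of prescribed parity relative to a pair

side : ∀ {N} → Bool → Subset N → Subset N
side true  p = p
side false p = ∁ p

∈-side : ∀ {N} δ (p : Subset N) {z} → lookup p z ≡ δ → z ∈ side δ p
∈-side true  p {z} eq = lookup⇒[]= z p eq
∈-side false p {z} eq = lookup⇒[]= z (∁ p) (trans (lookup-map z not p) (cong not eq))

tint : Bool → Colour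
tint true  = red
tint false = blue

tint-injective : ∀ {a b} → tint a ≡ tint b → a ≡ b
tint-injective {false} {false} _ = refl
tint-injective {true}  {true}  _ = refl

module _ {m N} (H : Graph N) (bal : IsBalanced m H) where
  open IsBalanced bal

  private
    e : Fin N → Fin N → Bool
    e = adjᵇ H

    complementary : ∀ {a b} (p : Subset N) → 2 * suc m ≡ a + b → ∣ p ∣ ≡ a → ∣ ∁ p ∣ ≡ b
    complementary {a} {b} p eq ∣p∣≡a = begin
      ∣ ∁ p ∣             ≡⟨ ∣∁p∣≡n∸∣p∣ p ⟩
      N ∸ ∣ p ∣           ≡⟨ cong₂ _∸_ (trans order eq) ∣p∣≡a ⟩
      a + b ∸ a           ≡⟨ m+n∸m≡n a b ⟩
      b                   ∎
      where open ≡-Reasoning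

  -- Complementing in `2 * m + 2` points exchanges the sizes `m` and `m + 2`, so adjacent and
  -- non-adjacent pairs give the same count.
  ∣side-adjᵇ∣ : ∀ {x y} → x ≢ y → ∣ side (e x y) (separating H x y) ∣ ≡ 2 + m
  ∣side-adjᵇ∣ {x} {y} x≢y with adj? H x y
  ... | yes xy = adjacent xy
  ... | no ¬xy = complementary (separating H x y) (h m) (nonAdjacent x≢y ¬xy)
    where
    h : ∀ m → 2 * suc m ≡ m + (2 + m)
    h = solve-∀

  ∣side-not-adjᵇ∣ : ∀ {x y} → x ≢ y → ∣ side (not (e x y)) (separating H x y) ∣ ≡ m
  ∣side-not-adjᵇ∣ {x} {y} x≢y with adj? H x y
  ... | yes xy = complementary (separating H x y) (h m) (adjacent xy)
    where
    h : ∀ m → 2 * suc m ≡ 2 + m + m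
    h = solve-∀
  ... | no ¬xy = nonAdjacent x≢y ¬xy

  few-separated : ∀ δ {x y} → x ≢ y → ¬ (∃ λ (z : Fin (suc m) → Fin N) →
    Injective _≡_ _≡_ z × (∀ i → z i ≢ x) × (∀ i → z i ≢ y) ×
    (∀ i → e x (z i) xor e y (z i) ≡ δ))
  few-separated δ {x} {y} x≢y (z , inj , z≢x , z≢y , zδ) with ≡-or-≡not δ (e x y)
  ... | inj₂ refl = contradiction
    (≤-trans (injection⇒≤∣∣ _ z inj z∈) (≤-reflexive (∣side-not-adjᵇ∣ x≢y))) 1+n≰n
    where
    z∈ : ∀ i → z i ∈ side (not (e x y)) (separating H x y)
    z∈ i = ∈-side _ _ (trans (lookup-separating H x y (z i)) (zδ i))
  ... | inj₁ refl = contradiction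
    (≤-trans (injection⇒≤∣∣ _ z⁺ inj⁺ z⁺∈) (≤-reflexive (∣side-adjᵇ∣ x≢y))) 1+n≰n
    where
    -- Here `x` and `y` lie in the counted set themselves; adjoining them to the `m + 1` given
    -- points exceeds its size `m + 2`.
    z⁺ : Fin (3 + m) → Fin N
    z⁺ zero          = x
    z⁺ (suc zero)    = y
    z⁺ (suc (suc i)) = z i

    inj⁺ : Injective _≡_ _≡_ z⁺
    inj⁺ {zero}        {zero}        _  = refl
    inj⁺ {zero}        {suc zero}    eq = contradiction eq x≢y
    inj⁺ {zero}        {suc (suc j)} eq = contradiction (sym eq) (z≢x j)
    inj⁺ {suc zero}    {zero}        eq = contradiction (sym eq) x≢y
    inj⁺ {suc zero}    {suc zero}    _  = refl
    inj⁺ {suc zero}    {suc (suc j)} eq = contradiction (sym eq) (z≢y j)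
    inj⁺ {suc (suc i)} {zero}        eq = contradiction eq (z≢x i)
    inj⁺ {suc (suc i)} {suc zero}    eq = contradiction eq (z≢y i)
    inj⁺ {suc (suc i)} {suc (suc j)} eq = cong (λ k → suc (suc k)) (inj eq)

    z⁺-parity : ∀ i → e x (z⁺ i) xor e y (z⁺ i) ≡ e x y
    z⁺-parity zero          = trans (cong (_xor e y x) (adjᵇ-refl H x)) (adjᵇ-sym H y x)
    z⁺-parity (suc zero)    =
      trans (xor-comm (e x y) (e y y)) (cong (_xor e x y) (adjᵇ-refl H y))
    z⁺-parity (suc (suc i)) = zδ i

    z⁺∈ : ∀ i → z⁺ i ∈ side (e x y) (separating H x y)
    z⁺∈ i = ∈-side _ _ (trans (lookup-separating H x y (z⁺ i)) (z⁺-parity i))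

  -- The colouring of the double cover and its books

  γ : Bool × Fin N → Bool × Fin N → Colour
  γ (s , x) (t , y) with x ≟ y
  ... | yes _ = red
  ... | no  _ = tint (e x y xor (s xor t))

  γ-antipodal : ∀ s t x → γ (s , x) (t , x) ≡ red
  γ-antipodal s t x with x ≟ x
  ... | yes _  = refl
  ... | no x≢x = contradiction refl x≢x

  γ-apart : ∀ s t {x y} → x ≢ y → γ (s , x) (t , y) ≡ tint (e x y xor (s xor t))
  γ-apart s t {x} {y} x≢y with x ≟ y
  ... | yes x≡y = contradiction x≡y x≢y
  ... | no _    = refl

  γ-sym : ∀ u w → γ u w ≡ γ w u
  γ-sym (s , x) (t , y) with x ≟ y | y ≟ x
  ... | yes _   | yes _   = refl
  ... | yes x≡y | no y≢x  = contradiction (sym x≡y) y≢x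
  ... | no x≢y  | yes y≡x = contradiction (sym y≡x) x≢y
  ... | no _    | no _    = cong tint (cong₂ _xor_ (adjᵇ-sym H x y) (xor-comm s t))


  -- A page over `x` would be the antipode of `(s , x)`, but `(t , y)` is joined to these two
  -- antipodes in different colours.
  page-avoids : ∀ {k s t c x y z} → x ≢ y → (s , x) ≢ (c , z) →
    γ (s , x) (t , y) ≡ k → γ (s , x) (c , z) ≡ k → γ (t , y) (c , z) ≡ k → z ≢ x
  page-avoids {k} {s} {t} {c} {x} {y} x≢y u≢p uw up wp refl = u≢p (cong (_, x) s≡c)
    where
    open ≡-Reasoning
    s≡c : s ≡ c
    s≡c = xor-cancelʳ t (xor-cancelˡ (e x y) (tint-injective (begin
      tint (e x y xor (s xor t)) ≡⟨ γ-apart s t x≢y ⟨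
      γ (s , x) (t , y)          ≡⟨ trans uw (sym wp) ⟩
      γ (t , y) (c , x)          ≡⟨ γ-sym (t , y) (c , x) ⟩
      γ (c , x) (t , y)          ≡⟨ γ-apart c t x≢y ⟩
      tint (e x y xor (c xor t)) ∎)))

  -- A vertex over another point sees two antipodes in different colours, and the fibre over `x` has
  -- no third vertex.
  antipodal-no-page : ∀ {k s t c x z} → s ≢ t → (s , x) ≢ (c , z) → (t , x) ≢ (c , z) →
    ¬ (γ (s , x) (c , z) ≡ k × γ (t , x) (c , z) ≡ k)
  antipodal-no-page {s = s} {t} {c} {x} {z} s≢t u≢p w≢p (up , wp) with x ≟ z
  ... | no _ = s≢t (xor-cancelʳ c (xor-cancelˡ (e x z) (tint-injective (trans up (sym wp)))))
  ... | yes refl with ≡-or-≡not s c | ≡-or-≡not t c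
  ...   | inj₁ s≡c | _        = u≢p (cong (_, x) s≡c)
  ...   | inj₂ _   | inj₁ t≡c = w≢p (cong (_, x) t≡c)
  ...   | inj₂ s≡c̄ | inj₂ t≡c̄ = s≢t (trans s≡c̄ (sym t≡c̄))

  no-monochromatic-book : ∀ {k} (f : Fin (2 + suc m) → Bool × Fin N) → Injective _≡_ _≡_ f →
    ¬ (∀ {i j} → Adj (B (suc m)) i j → γ (f i) (f j) ≡ k)
  no-monochromatic-book {k} f inj mono =
    by-spine (f zero) (f (suc zero)) (f ∘ page) (suc-injective ∘ suc-injective ∘ inj)
      (0≢1+n ∘ inj) (λ i → 0≢1+n ∘ inj) (λ i → 0≢1+n ∘ suc-injective ∘ inj)
      -- The spine is the edge of `K 2`; adjacency of a spine vertex to a page is the trivial `⊤` of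
      -- the join.
      (mono {zero} {suc zero} λ ())
      (λ i → mono {zero} {page i} _) (λ i → mono {suc zero} {page i} _)
    where
    page : Fin (suc m) → Fin (2 + suc m)
    page i = suc (suc i)

    by-spine : ∀ u w (p : Fin (suc m) → Bool × Fin N) → Injective _≡_ _≡_ p →
      u ≢ w → (∀ i → u ≢ p i) → (∀ i → w ≢ p i) →
      γ u w ≡ k → (∀ i → γ u (p i) ≡ k) → (∀ i → γ w (p i) ≡ k) → ⊥
    by-spine (s , x) (t , y) p p-inj u≢w u≢p w≢p uw up wp with x ≟ y
    ... | yes refl =
      antipodal-no-page (u≢w ∘ cong (_, x)) (u≢p zero) (w≢p zero) (up zero , wp zero)
    ... | no x≢y =
      few-separated (s xor t) x≢y (z , z-inj , z≢x , z≢y , parity)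
      where
      c : Fin (suc m) → Bool
      c = proj₁ ∘ p

      z : Fin (suc m) → Fin N
      z = proj₂ ∘ p

      z≢x : ∀ i → z i ≢ x
      -- Matching on `x ≟ y` has unfolded `γ` in the type of `uw`; `γ-apart` folds it back.
      z≢x i = page-avoids x≢y (u≢p i) (trans (γ-apart s t x≢y) uw) (up i) (wp i)

      z≢y : ∀ i → z i ≢ y
      z≢y i = page-avoids (x≢y ∘ sym) (w≢p i)
        (trans (γ-sym (t , y) (s , x)) (trans (γ-apart s t x≢y) uw)) (wp i) (up i)

      -- With the sheet `c i` moved to the front, `xor-exchange₂` can eliminate it for `parity`, and
      -- cancelling `s` recovers it for `z-inj`.
      up′ : ∀ i → tint (e x (z i) xor (c i xor s)) ≡ k
      up′ i = trans (cong (λ b → tint (e x (z i) xor b)) (xor-comm (c i) s))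
        (trans (sym (γ-apart s (c i) (z≢x i ∘ sym))) (up i))

      wp′ : ∀ i → tint (e y (z i) xor (c i xor t)) ≡ k
      wp′ i = trans (cong (λ b → tint (e y (z i) xor b)) (xor-comm (c i) t))
        (trans (sym (γ-apart t (c i) (z≢y i ∘ sym))) (wp i))

      parity : ∀ i → e x (z i) xor e y (z i) ≡ s xor t
      parity i = xor-exchange₂ (e x (z i)) (e y (z i)) (c i) s t
        (tint-injective (trans (up′ i) (sym (wp′ i))))

      z-inj : Injective _≡_ _≡_ z
      z-inj {i} {j} zi≡zj = p-inj (cong₂ _,_ ci≡cj zi≡zj)
        where
        ci≡cj : c i ≡ c j
        ci≡cj = xor-cancelʳ s (xor-cancelˡ (e x (z j)) (tint-injective (trans
          (cong (λ v → tint (e x v xor (c i xor s))) (sym zi≡zj))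
          (trans (up′ i) (sym (up′ j))))))

  -- The Ramsey lower bound

  arrows-lower-bound : ∀ M → Arrows (B (suc m)) (B (suc m)) M → 2 * N + 1 ≤ M
  arrows-lower-bound M arrows with M ≤? 2 * N
  ... | no  M≰2N = ≤-trans (≤-reflexive (+-comm (2 * N) 1)) (≰⇒> M≰2N)
  ... | yes M≤2N = contradiction (arrows colouring) [ no-copy , no-copy ]′
    where
    vertices : Fin (2 * N) ↔ (Bool × Fin N)
    vertices = (2↔Bool ×-↔ ↔-id (Fin N)) ↔-∘ *↔×

    -- For `M` below `2 * N`, the colouring is `γ` restricted to the first `M` vertices.
    vertex : Fin M → Bool × Fin N
    vertex i = Inverse.to vertices (inject≤ i M≤2N)

    vertex-injective : Injective _≡_ _≡_ vertex
    vertex-injective {i} {j} =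
      inject≤-injective M≤2N M≤2N i j ∘ Injection.injective (↔⇒↣ vertices)

    colouring : Colouring M
    colouring = record
      { colour = λ i j → γ (vertex i) (vertex j)
      ; csym   = λ i j → γ-sym (vertex i) (vertex j)
      }

    no-copy : ∀ {k} → ¬ HasCopy colouring k (B (suc m))
    no-copy (f , inj , mono) =
      no-monochromatic-book (vertex ∘ f) (inj ∘ vertex-injective) mono

R-≥ : ∀ {s t} (G : Graph s) (H : Graph t) L → (∀ M → Arrows G H M → L ≤ M) → R G H ≥ L
R-≥ G H L lower = lower (R G H) (proj₁ (R-isRamseyNumber G H))

theorem1p1 : (n : ℕ) → .{{_ : NonZero n}} →
    ∃ (λ (G : Graph (2 * n ∸ 1)) → IsPCGraph G) →
    R (B n) (B n) ≥ 4 * n + 1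
theorem1p1 (suc m) (G , pc) =
  R-≥ (B (suc m)) (B (suc m)) (4 * suc m + 1) λ M arrows →
    -- The cone has `2 * suc m` vertices, and the double cover twice as many.
    subst (λ N → N + 1 ≤ M) (4n≡ m)
      (arrows-lower-bound (K 1 ⊕ G) (cone-balanced m G pc) M arrows)
  where
  4n≡ : ∀ m → 2 * (2 * suc m) ≡ 4 * suc m
  4n≡ = solve-∀
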